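{- Let $m\ge 1$ be an integer, let $x_1,\dots,x_m$ be elements of a commutative ring, and let $B_m(x_1,\dots,x_m)$ be the $m\times m$ matrix whose $(p,q)$ entry is $x_{\max(p,q)}$ for $1\le p,q\le m$. Then $$\det B_m(x_1,\dots,x_m)=\prod_{i=1}^{m}(x_i-x_{i+1}),\qquad\text{where } x_{m+1}=0.$$
   Context: The matrix is, explicitly, $$B_m(x_1,\dots,x_m)=\begin{pmatrix} x_1 & x_2 & \cdots & x_{m-1} & x_m\\ x_2 & x_2 & \cdots & x_{m-1} & x_m\\ \vdots&\vdots&\ddots&\vdots&\vdots\\ x_{m-1} & x_{m-1} & \cdots & x_{m-1} & x_m\\ x_m & x_m&\cdots & x_m & x_m\end{pmatrix}.$$ -}

module Defs where

open import Algebra.Bundles using (CommutativeRing; Semiring)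
open import Algebra.Construct.NaturalChoice.Max using () renaming (_⊔_ to max)
import Algebra.Definitions.RawMonoid as RawMonoid
import Algebra.Definitions.RawSemiring as RawSemiring
open import Data.Bool.Base using (if_then_else_)
open import Data.Fin.Base using (Fin; zero; suc; inject₁; fromℕ; punchIn)
open import Data.Fin.Permutation using (Permutation′; id; insert; remove; _⟨$⟩ʳ_; insert-remove; insert-punchIn)
  renaming (_≈_ to _≈ₚ_)
open import Data.Fin.Properties using (≤-totalOrder; _<?_; punchIn-injective)
open import Data.List.Base using (List; []; _∷_; map; foldr; allFin; cartesianProductWith)
import Data.List.Membership.Setoid as Membership
import Data.List.Membership.Setoid.Properties as MembershipProps
import Data.List.Membership.Propositional.Properties as MembershipPropsₚ
import Data.List.Relation.Unary.Unique.Setoid as Unique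
import Data.List.Relation.Unary.Unique.Setoid.Properties as UniqueProps
open import Data.List.Relation.Unary.Unique.Propositional.Properties using (allFin⁺)
import Data.List.Relation.Unary.All as All
open import Data.List.Relation.Unary.AllPairs using ([]; _∷_)
open import Data.List.Relation.Unary.Any using (here)
open import Data.Nat.Base using (ℕ; zero; suc; +-0-rawMonoid)
open import Data.Product.Base using (_×_; _,_)
open import Data.Vec.Functional using (Vector; insertAt)
open import Level using (0ℓ)
open import Relation.Binary.Bundles using (Setoid)
open import Relation.Binary.PropositionalEquality
  using (_≡_; refl; sym; trans; cong; setoid)
open import Relation.Nullary.Decidable using (does; _×-dec_)

Matrix : ∀ {a} → Set a → ℕ → Set a
Matrix A n = Fin n → Fin n → A

B : ∀ {a} {A : Set a} (m : ℕ) → Vector A m → Matrix A m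
B m x p q = x (max (≤-totalOrder m) p q)

-- A permutation of Fin (suc n) is determined by the image i of zero and by the
-- permutation of Fin n that remains once zero and i are removed.
permutations : (n : ℕ) → List (Permutation′ n)
permutations zero    = id ∷ []
permutations (suc n) = cartesianProductWith (insert zero) (allFin (suc n)) (permutations n)

inversions : ∀ {n} → Permutation′ n → ℕ
inversions σ = sum λ i → sum λ j →
  if does ((i <? j) ×-dec ((σ ⟨$⟩ʳ j) <? (σ ⟨$⟩ʳ i))) then 1 else 0
  where open RawMonoid +-0-rawMonoid using (sum)

module _ {c ℓ} (R : CommutativeRing c ℓ) where

  open CommutativeRing R
  open RawSemiring (Semiring.rawSemiring semiring) using (_^_; product)

  ∏ : ∀ {n} → Vector Carrier n → Carrier
  ∏ = product

  sign : ∀ {n} → Permutation′ n → Carrier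
  sign σ = (- 1#) ^ inversions σ

  det : ∀ {n} → Matrix Carrier n → Carrier
  det {n} A = foldr _+_ 0# (map (λ σ → sign σ * ∏ (λ i → A i (σ ⟨$⟩ʳ i))) (permutations n))

  -- (x₁, …, xₘ) extended by xₘ₊₁ = 0.
  extend : ∀ {m} → Vector Carrier m → Vector Carrier (suc m)
  extend {m} x = insertAt x (fromℕ m) 0#

-- The list of permutations contains each permutation exactly once, up to
-- pointwise equality.

permSetoid : ℕ → Setoid 0ℓ 0ℓ
permSetoid n = record
  { Carrier       = Permutation′ n
  ; _≈_           = _≈ₚ_
  ; isEquivalence = record
    { refl  = λ _ → refl
    ; sym   = λ e i → sym (e i)
    ; trans = λ e f i → trans (e i) (f i)
    }
  }

insert-cong : ∀ {n} {i j : Fin (suc n)} {σ τ : Permutation′ n} →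
              i ≡ j → σ ≈ₚ τ → insert zero i σ ≈ₚ insert zero j τ
insert-cong e    f zero    = e
insert-cong {σ = σ} {τ} refl f (suc k) =
  trans (insert-punchIn zero _ σ k)
    (trans (cong (punchIn _) (f k)) (sym (insert-punchIn zero _ τ k)))

insert-injective : ∀ {n} {i j : Fin (suc n)} {σ τ : Permutation′ n} →
                   insert zero i σ ≈ₚ insert zero j τ → i ≡ j × σ ≈ₚ τ
insert-injective {i = i} {σ = σ} {τ} e with refl ← e zero = refl , λ k →
  punchIn-injective i _ _
    (trans (sym (insert-punchIn zero i σ k)) (trans (e (suc k)) (insert-punchIn zero i τ k)))

permutations-complete : ∀ n (σ : Permutation′ n) → Membership._∈_ (permSetoid n) σ (permutations n)
permutations-complete zero    σ = here λ ()
permutations-complete (suc n) σ =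
  MembershipProps.∈-resp-≈ (permSetoid (suc n))
    {x = insert zero (σ ⟨$⟩ʳ zero) (remove zero σ)} {y = σ} (insert-remove zero σ)
    (MembershipProps.∈-cartesianProductWith⁺ (setoid (Fin (suc n))) (permSetoid n) (permSetoid (suc n))
      (λ {_} {_} {σ} {τ} → insert-cong {σ = σ} {τ})
      (MembershipPropsₚ.∈-allFin (σ ⟨$⟩ʳ zero))
      (permutations-complete n (remove zero σ)))

permutations-unique : ∀ n → Unique.Unique (permSetoid n) (permutations n)
permutations-unique zero    = All.[] ∷ []
permutations-unique (suc n) =
  UniqueProps.cartesianProductWith⁺ (setoid (Fin (suc n))) (permSetoid n) (permSetoid (suc n))
    (insert zero) (λ {_} {_} {σ} {τ} → insert-injective {σ = σ} {τ})
    (allFin⁺ (suc n)) (permutations-unique n)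

{-# OPTIONS --safe #-}

-- Below row 0, columns 0 and 1 of B agree. Whenever a matrix A has this property, only two
-- terms of the expansion along row 0 survive: the minors that keep both columns vanish by
-- induction, and those deleting column 0 or column 1 coincide, so det A is A₀₀ - A₀₁ times
-- the minor at (0, 0). For B that minor is again B, on the remaining variables.

module Submission where

open import Defs
open import Algebra.Bundles using (CommutativeRing; Semiring)
open import Algebra.Construct.NaturalChoice.Max using (x≤y⇒x⊔y≈y; x≤y⇒y⊔x≈y)
  renaming (_⊔_ to max)
import Algebra.Definitions.RawSemiring as RawSemiring
import Algebra.Properties.CommutativeMonoid.Sum as MonoidSum
import Algebra.Properties.CommutativeSemigroup as CommutativeSemigroupProperties
import Algebra.Properties.Ring as RingProperties
import Algebra.Properties.Semiring.Exp as Exp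
import Algebra.Properties.Semiring.Sum as SemiringSum
open import Data.Bool.Base using (Bool; if_then_else_)
open import Data.Fin.Base using (Fin; zero; suc; toℕ; inject₁; punchIn; _<_)
open import Data.Fin.Permutation using (Permutation′; insert; _⟨$⟩ʳ_)
open import Data.Fin.Properties using (≤-total; ≤-totalOrder; _<?_; punchIn-mono-≤; punchIn-cancel-≤)
open import Data.List.Base using (List; []; _∷_; _++_; map; foldr; tabulate; cartesianProductWith)
open import Data.Nat.Base as ℕ using (ℕ; zero; suc; _≤_; z≤n; s≤s)
import Data.Nat.Properties as ℕₚ
open import Data.Product.Base using (_,_)
open import Data.Sum.Base using (inj₁; inj₂)
open import Data.Vec.Functional using (Vector; tail)
open import Function.Base using (_∘_; id)
open import Function.Bundles using (_⇔_; mk⇔; module Equivalence)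
open import Relation.Binary.PropositionalEquality as ≡ using (_≡_)
open import Relation.Nullary.Decidable using (does; does-⇔; _×-dec_)

-- `max` is computed from `≤-total`, which is stuck on variables, so the case split is made by hand.
-- This turns the minor of `B` at (0, 0) into `B` of the tail.
max-suc : ∀ {n} (p q : Fin n) →
          max (≤-totalOrder (suc n)) (suc p) (suc q) ≡ suc (max (≤-totalOrder n) p q)
max-suc {n} p q with ≤-total p q
... | inj₁ p≤q = ≡.trans (x≤y⇒x⊔y≈y (≤-totalOrder (suc n)) (s≤s p≤q))
                         (≡.cong suc (≡.sym (x≤y⇒x⊔y≈y (≤-totalOrder n) p≤q)))
... | inj₂ q≤p = ≡.trans (x≤y⇒y⊔x≈y (≤-totalOrder (suc n)) (s≤s q≤p))
                         (≡.cong suc (≡.sym (x≤y⇒y⊔x≈y (≤-totalOrder n) q≤p)))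

indicator : Bool → ℕ
indicator b = if b then 1 else 0

module _ where

  open MonoidSum ℕₚ.+-0-commutativeMonoid

  count-< : ∀ {n} (i : Fin (suc n)) → sum (λ (k : Fin n) → indicator (does (k <? i))) ≡ toℕ i
  count-< {n}     zero    = sum-replicate-zero n
  count-< {suc n} (suc i) = ≡.cong suc (count-< i)

  -- `punchIn i` fixes everything below `i` and moves the rest strictly above it.
  punchIn-<-self : ∀ {n} (i : Fin (suc n)) (k : Fin n) → punchIn i k < i ⇔ k < i
  punchIn-<-self i k = mk⇔ (to i k) (from i k)
    where
    to : ∀ {n} (i : Fin (suc n)) (k : Fin n) → punchIn i k < i → k < i
    to (suc i) zero    _       = s≤s z≤n
    to (suc i) (suc k) (s≤s p) = s≤s (to i k p)
    from : ∀ {n} (i : Fin (suc n)) (k : Fin n) → k < i → punchIn i k < i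
    from (suc i) zero    _       = s≤s z≤n
    from (suc i) (suc k) (s≤s p) = s≤s (from i k p)

  punchIn-< : ∀ {n} (i : Fin (suc n)) (j k : Fin n) → punchIn i j < punchIn i k ⇔ j < k
  punchIn-< i j k = mk⇔
    (λ p → ℕₚ.≰⇒> λ k≤j → ℕₚ.<⇒≱ p (punchIn-mono-≤ i k j k≤j))
    (λ p → ℕₚ.≰⇒> λ k≤j → ℕₚ.<⇒≱ p (punchIn-cancel-≤ i k j k≤j))

  -- Position 0 carries the value `i` and is inverted with exactly the positions whose value is
  -- below `i`. Among the later positions, `punchIn i` preserves and reflects the order, so their
  -- inversions are those of `σ`.
  inversions-insert : ∀ {n} (i : Fin (suc n)) (σ : Permutation′ n) →
                      inversions (insert zero i σ) ≡ toℕ i ℕ.+ inversions σ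
  inversions-insert {n} i σ = ≡.cong₂ ℕ._+_ fromZero
    (sum-cong-≗ λ j → sum-cong-≗ λ k → ≡.cong indicator
      (does-⇔ (mk⇔ (λ (p , q) → ℕₚ.≤-pred p , Equivalence.to (punchIn-< i _ _) q)
                   (λ (p , q) → s≤s p , Equivalence.from (punchIn-< i _ _) q))
        ((suc j <? suc k) ×-dec (punchIn i (σ ⟨$⟩ʳ k) <? punchIn i (σ ⟨$⟩ʳ j)))
        ((j <? k) ×-dec ((σ ⟨$⟩ʳ k) <? (σ ⟨$⟩ʳ j)))))
    where
    open ≡.≡-Reasoning
    fromZero : sum (λ j → indicator (does (punchIn i (σ ⟨$⟩ʳ j) <? i))) ≡ toℕ i
    fromZero = begin
      sum (λ j → indicator (does (punchIn i (σ ⟨$⟩ʳ j) <? i)))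
        ≡⟨ sum-cong-≗ (λ j → ≡.cong indicator
             (does-⇔ (punchIn-<-self i (σ ⟨$⟩ʳ j)) (punchIn i (σ ⟨$⟩ʳ j) <? i) ((σ ⟨$⟩ʳ j) <? i))) ⟩
      sum (λ j → indicator (does ((σ ⟨$⟩ʳ j) <? i)))
        -- Since `σ` is a bijection, its values can be counted as all `k`.
        ≡⟨ sum-permute (λ (k : Fin n) → indicator (does (k <? i))) σ ⟨
      sum (λ (k : Fin n) → indicator (does (k <? i)))
        ≡⟨ count-< i ⟩
      toℕ i ∎

module _ {c ℓ} (R : CommutativeRing c ℓ) where

  open CommutativeRing R hiding (zero)
  open RawSemiring (Semiring.rawSemiring semiring) using (_^_)
  open SemiringSum semiring
  open Exp semiring using (^-homo-*; ^-congʳ)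
  open RingProperties ring using (-1*x≈-x; -0#≈0#)
  open CommutativeSemigroupProperties *-commutativeSemigroup using (interchange)
  open import Relation.Binary.Reasoning.Setoid setoid

  private
    module Product = MonoidSum *-commutativeMonoid

  listSum : ∀ {a} {A : Set a} → (A → Carrier) → List A → Carrier
  listSum f xs = foldr _+_ 0# (map f xs)

  listSum-cong : ∀ {a} {A : Set a} {f g : A → Carrier} → (∀ x → f x ≈ g x) →
                 ∀ xs → listSum f xs ≈ listSum g xs
  listSum-cong e []       = refl
  listSum-cong e (x ∷ xs) = +-cong (e x) (listSum-cong e xs)

  *-distribˡ-listSum : ∀ {a} {A : Set a} y (f : A → Carrier) xs →
                       y * listSum f xs ≈ listSum (λ x → y * f x) xs
  *-distribˡ-listSum y f []       = zeroʳ y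
  *-distribˡ-listSum y f (x ∷ xs) = trans (distribˡ y _ _) (+-congˡ (*-distribˡ-listSum y f xs))

  listSum-map-++ : ∀ {a b} {A : Set a} {B : Set b} (f : B → Carrier) (g : A → B) xs ys →
                   listSum f (map g xs ++ ys) ≈ listSum (f ∘ g) xs + listSum f ys
  listSum-map-++ f g []       ys = sym (+-identityˡ _)
  listSum-map-++ f g (x ∷ xs) ys = trans (+-congˡ (listSum-map-++ f g xs ys)) (sym (+-assoc _ _ _))

  -- The product list consists of one block for each `h i`. A general `tabulate h` in place of
  -- `allFin` lets the induction pass to `h ∘ suc`.
  listSum-cartesianProductWith : ∀ {a b d} {A : Set a} {B : Set b} {D : Set d} {n}
    (f : D → Carrier) (g : A → B → D) (h : Fin n → A) ys →
    listSum f (cartesianProductWith g (tabulate h) ys) ≈ sum (λ i → listSum (f ∘ g (h i)) ys)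
  listSum-cartesianProductWith {n = zero}  f g h ys = refl
  listSum-cartesianProductWith {n = suc n} f g h ys = trans
    (listSum-map-++ f (g (h zero)) ys _)
    (+-congˡ (listSum-cartesianProductWith f g (h ∘ suc) ys))

  det-cong : ∀ {n} {A A′ : Matrix Carrier n} → (∀ p q → A p q ≈ A′ p q) → det R A ≈ det R A′
  det-cong {n} e = listSum-cong (λ σ → *-congˡ (Product.sum-cong-≋ λ i → e i (σ ⟨$⟩ʳ i)))
    (permutations n)

  minor : ∀ {n} → Matrix Carrier (suc n) → Fin (suc n) → Matrix Carrier n
  minor A j p q = A (suc p) (punchIn j q)

  -- Laplace expansion along row 0: permutations are grouped by the image `j` of zero, and by
  -- `inversions-insert` this choice contributes the sign `(- 1#) ^ toℕ j`.
  det-expand : ∀ {n} (A : Matrix Carrier (suc n)) →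
               det R A ≈ sum (λ j → ((- 1#) ^ toℕ j * A zero j) * det R (minor A j))
  det-expand {n} A = begin
    det R A
      ≈⟨ listSum-cartesianProductWith (term A) (insert zero) id (permutations n) ⟩
    sum (λ j → listSum (term A ∘ insert zero j) (permutations n))
      ≈⟨ sum-cong-≋ (λ j → trans (listSum-cong (term-insert j) (permutations n))
           (sym (*-distribˡ-listSum _ (term (minor A j)) (permutations n)))) ⟩
    sum (λ j → ((- 1#) ^ toℕ j * A zero j) * det R (minor A j)) ∎
    where
    term : ∀ {n} → Matrix Carrier n → Permutation′ n → Carrier
    term A σ = sign R σ * ∏ R (λ i → A i (σ ⟨$⟩ʳ i))

    term-insert : ∀ j σ → term A (insert zero j σ) ≈ ((- 1#) ^ toℕ j * A zero j) * term (minor A j) σ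
    term-insert j σ = trans
      (*-congʳ (trans (^-congʳ (- 1#) (inversions-insert j σ))
                      (^-homo-* (- 1#) (toℕ j) (inversions σ))))
      -- The product over rows unfolds to `A zero j` times the product for the minor; only the sign
      -- of `σ` has to be moved past `A zero j`.
      (interchange _ _ _ _)

  mutual
    det-equalColumns-below : ∀ n (A : Matrix Carrier (suc (suc n))) →
      (∀ p → A (suc p) zero ≈ A (suc p) (suc zero)) →
      det R A ≈ (A zero zero - A zero (suc zero)) * det R (minor A zero)
    det-equalColumns-below n A e = begin
      det R A
        ≈⟨ det-expand A ⟩
      (1# * a) * D + (((- 1# * 1#) * b) * det R (minor A (suc zero)) + sum rest)
        ≈⟨ +-cong (*-congʳ (*-identityˡ a))
             (+-cong (*-cong (trans (*-congʳ (*-identityʳ _)) (-1*x≈-x b))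
                             (det-cong minor-one))
                     (trans (sum-cong-≋ rest≈0) (sum-replicate-zero n))) ⟩
      a * D + (- b * D + 0#)
        ≈⟨ +-congˡ (+-identityʳ _) ⟩
      a * D + - b * D
        ≈⟨ distribʳ D a (- b) ⟨
      (a - b) * D ∎
      where
      a = A zero zero
      b = A zero (suc zero)
      D = det R (minor A zero)
      rest : Vector Carrier n
      rest k = ((- 1#) ^ toℕ (suc (suc k)) * A zero (suc (suc k))) * det R (minor A (suc (suc k)))
      rest≈0 : ∀ k → rest k ≈ 0#
      rest≈0 k = trans (*-congˡ (det-minor-equalColumns n A e k)) (zeroʳ _)
      minor-one : ∀ p q → minor A (suc zero) p q ≈ minor A zero p q
      -- Only the first column differs: it is column 0 of `A` on the left and column 1 on the right.
      minor-one p zero    = e p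
      minor-one p (suc q) = refl

    -- The minor keeps columns 0 and 1, so `det-equalColumns-below` applies one size down. Its row 0
    -- is row 1 of `A`, where the two columns agree as well, so the leading difference vanishes. For
    -- `n = 0` there is no `k`.
    det-minor-equalColumns : ∀ n (A : Matrix Carrier (suc (suc n))) →
      (∀ p → A (suc p) zero ≈ A (suc p) (suc zero)) →
      ∀ k → det R (minor A (suc (suc k))) ≈ 0#
    det-minor-equalColumns (suc n) A e k = begin
      det R A′
        ≈⟨ det-equalColumns-below n A′ (e ∘ suc) ⟩
      (A′ zero zero - A′ zero (suc zero)) * det R (minor A′ zero)
        ≈⟨ *-congʳ (trans (+-congʳ (e zero)) (-‿inverseʳ _)) ⟩
      0# * det R (minor A′ zero)
        ≈⟨ zeroˡ _ ⟩
      0# ∎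
      where A′ = minor A (suc (suc k))

  det-B : ∀ m (x : Vector Carrier m) →
          det R (B m x) ≈ ∏ R (λ i → extend R x (inject₁ i) - extend R x (suc i))
  det-B zero          x = trans (+-identityʳ _) (*-identityˡ _)
  det-B (suc zero)    x = begin
    det R (B 1 x)                        ≈⟨ det-expand (B 1 x) ⟩
    -- `1# * 1# + 0#` is the determinant of the empty matrix. In the target, the subtracted `0#` is
    -- the entry appended by `extend`.
    (1# * x zero) * (1# * 1# + 0#) + 0#  ≈⟨ +-identityʳ _ ⟩
    (1# * x zero) * (1# * 1# + 0#)       ≈⟨ *-cong (*-identityˡ _) (trans (+-identityʳ _) (*-identityˡ _)) ⟩
    x zero * 1#                          ≈⟨ *-congʳ (trans (+-congˡ -0#≈0#) (+-identityʳ _)) ⟨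
    (x zero - 0#) * 1#                   ∎
  det-B (suc (suc m)) x = begin
    det R (B (suc (suc m)) x)
      ≈⟨ det-equalColumns-below m (B (suc (suc m)) x) columns ⟩
    (x zero - x (suc zero)) * det R (minor (B (suc (suc m)) x) zero)
      -- Shifted by one index, `extend R x` is `extend R (tail x)` by computation, so the induction
      -- hypothesis supplies the remaining factors as they stand.
      ≈⟨ *-congˡ (trans (det-cong λ p q → reflexive (≡.cong x (max-suc p q))) (det-B (suc m) (tail x))) ⟩
    ∏ R (λ i → extend R x (inject₁ i) - extend R x (suc i)) ∎
    where
    columns : ∀ p → B (suc (suc m)) x (suc p) zero ≈ B (suc (suc m)) x (suc p) (suc zero)
    -- Both column indices are at most `suc p`, so both entries are `x (suc p)`; splitting on `p`
    -- lets `max` evaluate.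
    columns zero    = refl
    columns (suc p) = refl

proposition1p2 : ∀ {c ℓ} (R : CommutativeRing c ℓ) → let open CommutativeRing R in
    (m : ℕ) → 1 ≤ m → (x : Vector Carrier m) →
    det R (B m x) ≈ ∏ R (λ i → extend R x (inject₁ i) - extend R x (suc i))
proposition1p2 R m _ x = det-B R m x
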